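{- Let $G$ be an infinite abelian group, and let $H \in \mathbb{N}$ and $m_1, \ldots, m_H \in \mathbb{Z}$. Then there exist finite sets $A,B \subseteq G$ such that $$|hA|-|hB|=m_h$$ for each $1 \leq h \leq H$.
   Context: $\mathbb{N}$ denotes the positive integers. For a subset $A$ of an abelian group $G$ and $h \in \mathbb{N}$, the $h$-fold iterated sumset is $hA:=\{a_1+\cdots+a_h : a_1,\ldots,a_h \in A\}$ (repetitions allowed). $|X|$ denotes the cardinality of a finite set $X$. -}

module Defs where

open import Level using (Level; _⊔_)
open import Algebra.Bundles using (AbelianGroup)
open import Data.List.Base using (List; length)
open import Data.Nat.Base using (ℕ)
open import Data.Product.Base using (Σ-syntax; ∃-syntax; _×_)
open import Data.Vec.Functional using (Vector)
open import Data.Vec.Functional.Relation.Unary.All using (All)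
open import Function.Bundles using (_⇔_)
open import Relation.Binary.PropositionalEquality.Core using (_≡_)
open import Relation.Nullary.Negation.Core using (¬_)
open import Relation.Unary using (Pred; U)

import Algebra.Properties.CommutativeMonoid.Sum as Sum
import Data.List.Membership.Setoid as Membership
import Data.List.Relation.Unary.Unique.Setoid as UniqueSetoid

module Sumsets {c ℓ : Level} (G : AbelianGroup c ℓ) where

  open AbelianGroup G using (Carrier; _≈_; setoid; commutativeMonoid)
  open Sum commutativeMonoid using (sum)
  open Membership setoid using (_∈_)
  open UniqueSetoid setoid using (Unique)

  -- Elements are counted up to _≈_. A predicate that has a cardinality
  -- automatically respects _≈_, since list membership does; so a finite
  -- predicate is a finite subset of the group.
  HasCardinality : {p : Level} → Pred Carrier p → ℕ → Set (c ⊔ ℓ ⊔ p)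
  HasCardinality P n =
    Σ[ xs ∈ List Carrier ] Unique xs × length xs ≡ n × (∀ g → P g ⇔ g ∈ xs)

  IsFinite : {p : Level} → Pred Carrier p → Set (c ⊔ ℓ ⊔ p)
  IsFinite P = ∃[ n ] HasCardinality P n

  Infinite : Set (c ⊔ ℓ)
  Infinite = ¬ IsFinite U

  infixr 8 _·_

  _·_ : {p : Level} → ℕ → Pred Carrier p → Pred Carrier (c ⊔ ℓ ⊔ p)
  (h · A) g = Σ[ a ∈ Vector Carrier h ] All A a × sum a ≈ g

{-# OPTIONS --safe #-}
module Submission where

open import Defs
open import Level using (_⊔_; 0ℓ; Lift; lift) renaming (suc to ℓsuc)
open import Algebra.Bundles using (AbelianGroup)
open import Axiom.ExcludedMiddle using (ExcludedMiddle)
open import Data.Bool.Base using (true; false; if_then_else_)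
open import Data.Empty using (⊥; ⊥-elim)
open import Data.Fin.Base using (Fin; toℕ; zero; suc; fromℕ<; _↑ˡ_; _↑ʳ_; splitAt)
open import Data.Fin.Patterns using (0F; 1F; 2F)
open import Data.Integer.Base as ℤ using (ℤ; +_; -[1+_]; _-_)
open import Data.Integer.Tactic.RingSolver using (solve-∀)
open import Data.List.Base
  using (List; []; _∷_; _++_; map; length; lookup; replicate; take; upTo; allFin; cartesianProductWith)
open import Data.List.Membership.Propositional using (_∈_; _∉_)
open import Data.List.Membership.Propositional.Properties
  using (∈-∃++; ∈-++⁺ˡ; ∈-++⁺ʳ; ∈-++⁻; ∈-map⁺; ∈-map⁻; ∈-lookup; ∈-upTo⁺)
open import Data.List.Properties
  using (length-map; length-++; length-take; length-tabulate; map-++; map-∘; map-tabulate;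
         tabulate-cong; tabulate-lookup; ∷-injectiveʳ)
open import Data.List.Relation.Binary.Permutation.Propositional
  using (_↭_; ↭-refl; ↭-sym; ↭-trans; ↭-swap; prep; ↭⇒↭ₛ)
open import Data.List.Relation.Unary.All as All using (All; []; _∷_)
open import Data.List.Relation.Unary.AllPairs using ([]; _∷_)
open import Data.List.Relation.Unary.Any as Any using (Any; here; there)
open import Data.List.Relation.Unary.Unique.Propositional using (Unique)
open import Data.Nat.Base
  using (ℕ; zero; suc; NonZero; >-nonZero⁻¹; _+_; _*_; _∸_; _⊓_; _≤_; _<_; z≤n; s≤s)
open import Data.Nat.Combinatorics using (_C_; nCn≡1; k>n⇒nCk≡0; nCk+nC[k+1]≡[n+1]C[k+1])
open import Data.Nat.ListAction using (sum)
open import Data.Nat.ListAction.Properties using (sum-++; sum-↭)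
open import Data.Product.Base using (Σ-syntax; ∃-syntax; _×_; _,_; proj₁; proj₂)
open import Data.Product.Function.NonDependent.Propositional using (_×-↔_)
open import Data.Product.Properties using (,-injectiveʳ)
open import Data.Sum.Base using (_⊎_; inj₁; inj₂; [_,_]′)
open import Data.Sum.Function.Propositional using (_⊎-↔_)
open import Data.Unit.Base using (⊤; tt)
open import Data.Vec.Functional using (Vector)
open import Function.Base using (_∘_; id; case_of_)
open import Function.Bundles using (_↔_; mk⇔; Inverse; Equivalence)
open import Function.Construct.Composition using (_↔-∘_)
open import Relation.Binary.Definitions using (DecidableEquality; _Respects_)
open import Relation.Binary.PropositionalEquality.Core using (_≡_)
open import Relation.Binary.PropositionalEquality as ≡ using (_≢_; _≗_; cong; cong₂; module ≡-Reasoning)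
open import Relation.Nullary using (¬_; Dec; yes; no; does)
open import Relation.Nullary.Decidable using (dec-true; dec-false)
open import Relation.Unary using (Pred; Decidable)

import Algebra.Properties.CommutativeMonoid.Mult as Mult
import Algebra.Properties.CommutativeMonoid.Sum as Sum
import Algebra.Properties.Group as GroupProperties
import Data.Fin.Properties as Fin
import Data.Integer.Properties as ℤ
import Data.List.Membership.DecPropositional as DecMembership
import Data.List.Membership.Setoid as Membership
import Data.List.Membership.Setoid.Properties as Memₚ
import Data.List.Relation.Binary.Permutation.Propositional.Properties as Permₚ
import Data.List.Relation.Binary.Permutation.Setoid.Properties as Permₛ
import Data.List.Relation.Unary.All.Properties as Allₚ
import Data.List.Relation.Unary.Unique.Propositional.Properties as Uniqueₚ
import Data.List.Relation.Unary.Unique.Setoid as UniqueSetoid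
import Data.List.Relation.Unary.Unique.Setoid.Properties as UniqueSetoidₚ
import Data.Nat.Properties as ℕ
import Data.Product.Properties as Product
import Data.Sum.Properties as Sum⊎
import Relation.Binary.Reasoning.Setoid as SetoidReasoning

-- Fix K. By excluded middle, an infinite abelian group contains x₁, …, xₘ ≠ 0
-- for which an equation Σ aᵢxᵢ = Σ bᵢxᵢ with all aᵢ, bᵢ ≤ K forces aᵢxᵢ = bᵢxᵢ
-- for every i; in particular aᵢ and bᵢ never differ by exactly 1. Torsion is
-- harmless because only such differences are used below.
--
-- From the xᵢ one builds a finite set S together with points r_c ∉ S and t_j ∈ S
-- and prescribed sets T_c of indices j such that, for every set C of indices c,
-- h(S ∪ {r_c : c ∈ C}) is the disjoint union of hS and the pairwise distinct
-- points r_c + Σ_{j ∈ p} t_j with c ∈ C, p ⊆ T_c and |p| = h − 1. Its size is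
-- therefore |hS| + Σ_{c ∈ C} binom(|T_c|, h − 1). Taking A and B of this form
-- with the same S, the difference |hA| − |hB| is an integer combination of the
-- rows of Pascal's triangle, and these form a unitriangular matrix.

-- The set S only just misses each r_c. Along an extra generator δ, points may be offset by -1, 0 or
-- 1: S contains r_c ± δ but not r_c, and each t_j at offset 0 only. Each bad pair of colours gets
-- two auxiliary families in S, present at all three offsets, whose sums recover the sum of the
-- pair. So r_c plus elements of S can be rewritten inside S as soon as another point of root
-- colour, an auxiliary point, some t_j with j outside T_c, or a repeated t_j takes part (`absorb`,
-- `expand`). What remains is r_c plus distinct t_j with j in T_c, and comparing coefficients shows
-- that such a sum lies outside hS (`avoid`) and determines c and the set of j (`spike-injective`).
--
-- These comparisons only need that coefficients of equal elements never differ by exactly 1, which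
-- the family built in `independent` guarantees. Counting gives `sumset-cardinality`, and
-- `gap-surjective` chooses the sizes of the T_c by back substitution.

∈⇒↭ : ∀ {a} {A : Set a} {x : A} {xs} → x ∈ xs → ∃[ ys ] xs ↭ x ∷ ys
∈⇒↭ x∈xs with ys , zs , ≡.refl ← ∈-∃++ x∈xs = ys ++ zs , Permₚ.shift _ ys zs

unique-↭ : ∀ {a} {A : Set a} {xs ys : List A} → xs ↭ ys → Unique xs → Unique ys
unique-↭ {A = A} xs↭ys = Permₛ.Unique-resp-↭ (≡.setoid A) (↭⇒↭ₛ xs↭ys)

-- Each head of `xs` is deleted from `ys`; distinctness keeps the remaining entries inside what is
-- left.
pigeonhole : ∀ {a} {A : Set a} {xs ys : List A} → Unique xs → All (_∈ ys) xs →
             length xs ≡ length ys → xs ↭ ys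
pigeonhole {ys = []} [] [] _ = ↭-refl
pigeonhole {ys = ys} (x∉xs ∷ xs!) (x∈ys ∷ xs⊆ys) eq with zs , ys↭ ← ∈⇒↭ x∈ys =
  ↭-trans (prep _ (pigeonhole xs! (All.zipWith drop (x∉xs , xs⊆ys))
    (ℕ.suc-injective (≡.trans eq (Permₚ.↭-length ys↭))))) (↭-sym ys↭)
  where
  drop : ∀ {y} → _ ≢ y × y ∈ ys → y ∈ zs
  drop (x≢y , y∈ys) with Permₚ.∈-resp-↭ ys↭ y∈ys
  ... | here y≡x = ⊥-elim (x≢y (≡.sym y≡x))
  ... | there y∈zs = y∈zs

-- Finiteness from covering lists

module Finiteness {c ℓ} (em : ExcludedMiddle (c ⊔ ℓ)) (G : AbelianGroup c ℓ) where

  open AbelianGroup G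
  open Sumsets G
  open Membership setoid using () renaming (_∈_ to _∈ᴳ_)
  open UniqueSetoid setoid using () renaming (Unique to Uniqueᴳ)

  Covered : ∀ {p} → Pred Carrier p → Set (c ⊔ ℓ ⊔ p)
  Covered P = ∃[ xs ] (∀ {g} → P g → g ∈ᴳ xs)

  -- The covering list is pruned of outsiders and repetitions. Equality in `G` need not be
  -- decidable, so excluded middle tests for repetitions.
  covered⇒finite : ∀ {p} {P : Pred Carrier p} → Decidable P → P Respects _≈_ →
                   Covered P → IsFinite P
  covered⇒finite {P = P} P? resp (xs , cover) =
    let ys , ys! , sound , complete = extract xs in
    length ys , ys , ys! , ≡.refl , λ g → mk⇔ (λ Pg → complete Pg (cover Pg)) sound
    where
    extract : ∀ xs → ∃[ ys ] Uniqueᴳ ys × (∀ {g} → g ∈ᴳ ys → P g) ×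
                             (∀ {g} → P g → g ∈ᴳ xs → g ∈ᴳ ys)
    extract [] = [] , [] , (λ ()) , λ _ ()
    extract (x ∷ xs) with extract xs | P? x
    ... | ys , ys! , sound , complete | no ¬Px =
      ys , ys! , sound , λ { Pg (here g≈x) → ⊥-elim (¬Px (resp g≈x Pg))
                           ; Pg (there g∈) → complete Pg g∈ }
    ... | ys , ys! , sound , complete | yes Px with em {x ∈ᴳ ys}
    ...   | yes x∈ys = ys , ys! , sound ,
      λ { Pg (here g≈x) → Memₚ.∈-resp-≈ setoid (sym g≈x) x∈ys
        ; Pg (there g∈) → complete Pg g∈ }
    ...   | no x∉ys = x ∷ ys , Allₚ.¬Any⇒All¬ ys x∉ys ∷ ys! ,
      (λ { (here g≈x) → resp (sym g≈x) Px ; (there g∈) → sound g∈ }) ,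
      λ { Pg (here g≈x) → here g≈x ; Pg (there g∈) → there (complete Pg g∈) }

-- Independent families in an infinite abelian group

module Freeness {c ℓ} (em : ExcludedMiddle (c ⊔ ℓ)) (G : AbelianGroup c ℓ)
                (G-infinite : Sumsets.Infinite G) where

  open AbelianGroup G renaming (_-_ to _//_)
  open GroupProperties group using (∙-cancelˡ; ∙-cancelʳ; //-rightDividesˡ)
  open Sum commutativeMonoid using (sum-cong-≋; ∑-distrib-+) renaming (sum to sumᴳ)
  open Mult commutativeMonoid using (×-congʳ; ×-congˡ; ×-homo-+; ×-distrib-+)
    renaming (_×_ to _⋆_)
  open Membership setoid using () renaming (_∈_ to _∈ᴳ_)
  open Finiteness em G
  open SetoidReasoning setoid

  private
    ⋆-ε : ∀ k → k ⋆ ε ≈ ε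
    ⋆-ε zero = refl
    ⋆-ε (suc k) = trans (identityˡ _) (⋆-ε k)

    ⋆-⁻¹ : ∀ k x → k ⋆ (x ⁻¹) ≈ (k ⋆ x) ⁻¹
    ⋆-⁻¹ k x = ∙-cancelˡ (k ⋆ x) _ _ (begin
      k ⋆ x ∙ k ⋆ (x ⁻¹) ≈⟨ ×-distrib-+ x (x ⁻¹) k ⟨
      k ⋆ (x ∙ x ⁻¹)     ≈⟨ ×-congʳ k (inverseʳ x) ⟩
      k ⋆ ε              ≈⟨ ⋆-ε k ⟩
      ε                  ≈⟨ inverseʳ (k ⋆ x) ⟨
      k ⋆ x ∙ (k ⋆ x) ⁻¹ ∎)

    ⋆-// : ∀ k x y → k ⋆ (x // y) ≈ k ⋆ x // k ⋆ y
    ⋆-// k x y = trans (×-distrib-+ x (y ⁻¹) k) (∙-congˡ (⋆-⁻¹ k y))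

  -- In either case multiplication by `k` takes each nonzero value only finitely often on a `Y`
  -- closed under differences.
  Killed : ℕ → Pred Carrier (c ⊔ ℓ) → Set (c ⊔ ℓ)
  Killed k Y = (∀ {y} → Y y → k ⋆ y ≈ ε) ⊎ Covered (λ y → Y y × k ⋆ y ≈ ε)

  -- Y is obtained from G by passing to the k-torsion whenever that is still
  -- infinite, for k = 1, …, K in turn.
  record Dichotomous (K : ℕ) : Set (ℓsuc (c ⊔ ℓ)) where
    field
      Y         : Pred Carrier (c ⊔ ℓ)
      closed    : ∀ {a b} → Y a → Y b → Y (a // b)
      uncovered : ¬ Covered Y
      killed    : ∀ k → k < K → Killed (suc k) Y

  dichotomous : ∀ K → Dichotomous K
  dichotomous zero = record
    { Y         = λ _ → Lift _ ⊤
    ; closed    = λ _ _ → lift tt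
    ; uncovered = λ (xs , cover) →
        G-infinite (covered⇒finite (λ _ → yes tt) (λ _ _ → tt) (xs , λ _ → cover (lift tt)))
    ; killed    = λ _ ()
    }
  dichotomous (suc K) with dichotomous K
  ... | D with em {Covered (λ y → Dichotomous.Y D y × suc K ⋆ y ≈ ε)}
  ...   | yes cov = record
    { Y = Y ; closed = closed ; uncovered = uncovered
    ; killed = λ k k<1+K → case k (ℕ.m<1+n⇒m<n∨m≡n k<1+K) }
    where
    open Dichotomous D
    case : ∀ k → k < K ⊎ k ≡ K → Killed (suc k) Y
    case k (inj₁ k<K)    = killed k k<K
    case k (inj₂ ≡.refl) = inj₂ cov
  -- The torsion part is still infinite and closed under differences, and the alternatives settled
  -- for smaller multipliers pass to subsets.
  ...   | no ¬cov = record
    { Y = λ y → Y y × suc K ⋆ y ≈ ε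
    ; closed = λ (Ya , a0) (Yb , b0) → closed Ya Yb ,
        trans (⋆-// (suc K) _ _) (trans (∙-cong a0 (⁻¹-cong b0)) (inverseʳ ε))
    ; uncovered = ¬cov
    ; killed = λ k k<1+K → case k (ℕ.m<1+n⇒m<n∨m≡n k<1+K) }
    where
    open Dichotomous D
    case : ∀ k → k < K ⊎ k ≡ K → Killed (suc k) (λ y → Y y × suc K ⋆ y ≈ ε)
    case k (inj₂ ≡.refl) = inj₁ proj₂
    case k (inj₁ k<K) with killed k k<K
    ... | inj₁ all          = inj₁ (all ∘ proj₁)
    ... | inj₂ (xs , cover) = inj₂ (xs , λ ((Yy , _) , z) → cover (Yy , z))

  module _ {K} (D : Dichotomous K) where
    open Dichotomous D

    private
      Clash : ℕ → Carrier → Pred Carrier (c ⊔ ℓ)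
      Clash k e y = Y y × k ⋆ y ≈ e × ¬ (k ⋆ y ≈ ε)

      -- Solutions of `suc k ⋆ y ≈ e` form a translate, by one solution `y₀`, of the torsion part of
      -- `Y`, which is covered unless it is all of `Y`; in that case no nonzero value is taken.
      clash-covered : ∀ k → k < K → ∀ e → Covered (Clash (suc k) e)
      clash-covered k k<K e with killed k k<K
      ... | inj₁ all = [] , λ (Yy , _ , ≉ε) → ⊥-elim (≉ε (all Yy))
      ... | inj₂ (xs , cover) with em {∃[ y ] Y y × suc k ⋆ y ≈ e}
      ...   | no ¬y = [] , λ (Yy , ≈e , _) → ⊥-elim (¬y (_ , Yy , ≈e))
      ...   | yes (y₀ , Yy₀ , y₀≈e) = map (_∙ y₀) xs , λ {y} (Yy , y≈e , _) →
        Memₚ.∈-resp-≈ setoid (//-rightDividesˡ y₀ y)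
          (Memₚ.∈-map⁺ setoid setoid ∙-congʳ (cover (closed Yy Yy₀ , (begin
            suc k ⋆ (y // y₀)          ≈⟨ ⋆-// (suc k) y y₀ ⟩
            suc k ⋆ y // suc k ⋆ y₀    ≈⟨ ∙-cong y≈e (⁻¹-cong y₀≈e) ⟩
            e // e                     ≈⟨ inverseʳ e ⟩
            ε                         ∎))))

      clashes-covered : ∀ k → k < K → ∀ es → Covered (λ y → Any (λ e → Clash (suc k) e y) es)
      clashes-covered k k<K [] = [] , λ ()
      clashes-covered k k<K (e ∷ es) =
        let xs , cover = clash-covered k k<K e
            ys , covers = clashes-covered k k<K es in
        xs ++ ys , λ { (here p) → Memₚ.∈-++⁺ˡ setoid (cover p)
                     ; (there p) → Memₚ.∈-++⁺ʳ setoid xs (covers p) }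

      all-clashes-covered : ∀ J → J ≤ K → ∀ es →
        Covered (λ y → ∃[ k ] k < J × Any (λ e → Clash (suc k) e y) es)
      all-clashes-covered zero J≤K es = [] , λ ()
      all-clashes-covered (suc J) J<K es =
        let xs , cover = clashes-covered J J<K es
            ys , covers = all-clashes-covered J (ℕ.<⇒≤ J<K) es
            member : ∀ {y k} → Any (λ e → Clash (suc k) e y) es → k < J ⊎ k ≡ J → y ∈ᴳ xs ++ ys
            member p = λ { (inj₁ k<J) → Memₚ.∈-++⁺ʳ setoid xs (covers (_ , k<J , p))
                         ; (inj₂ ≡.refl) → Memₚ.∈-++⁺ˡ setoid (cover p) } in
        xs ++ ys , λ (k , k<1+J , p) → member p (ℕ.m<1+n⇒m<n∨m≡n k<1+J)

    -- Finitely many elements of `Y` have a nonzero multiple among `es`, while `Y` is not covered by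
    -- any list, so some nonzero element of `Y` escapes them all.
    generic : ∀ es → ∃[ x ] ¬ x ≈ ε × (∀ k → k ≤ K → k ⋆ x ∈ᴳ es → k ⋆ x ≈ ε)
    generic es with all-clashes-covered K ℕ.≤-refl es
    ... | xs , cover with em {∃[ y ] Y y × ¬ y ∈ᴳ ε ∷ xs}
    ...   | no ¬y = ⊥-elim (uncovered (ε ∷ xs , inside))
      where
      inside : ∀ {g} → Y g → g ∈ᴳ ε ∷ xs
      inside {g} Yg with em {g ∈ᴳ ε ∷ xs}
      ... | yes g∈ = g∈
      ... | no g∉ = ⊥-elim (¬y (g , Yg , g∉))
    ...   | yes (x , Yx , x∉) = x , x∉ ∘ here , vanish
      where
      vanish : ∀ k → k ≤ K → k ⋆ x ∈ᴳ es → k ⋆ x ≈ ε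
      vanish zero _ _ = refl
      vanish (suc k) k<K kx∈ with em {Lift c (suc k ⋆ x ≈ ε)}
      ... | yes (lift kx≈ε) = kx≈ε
      ... | no kx≉ε = ⊥-elim (x∉ (there (cover
        (k , k<K , Any.map (λ kx≈e → Yx , kx≈e , kx≉ε ∘ lift) kx∈))))

  combination : ∀ {m} → (Fin m → Carrier) → (Fin m → ℕ) → Carrier
  combination x a = sumᴳ (λ i → a i ⋆ x i)

  combination-cong : ∀ {m} (x : Fin m → Carrier) {a b} → a ≗ b → combination x a ≈ combination x b
  combination-cong x a≗b = sum-cong-≋ (λ i → ×-congˡ (a≗b i))

  combination-+ : ∀ {m} (x : Fin m → Carrier) a b →
                  combination x (λ i → a i + b i) ≈ combination x a ∙ combination x b
  combination-+ x a b = trans (sum-cong-≋ (λ i → ×-homo-+ (x i) (a i) (b i)))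
                              (∑-distrib-+ (λ i → a i ⋆ x i) (λ i → b i ⋆ x i))

  -- The conclusion compares the multiples `a i ⋆ x i` rather than the coefficients, because the
  -- `x i` may have torsion. The list `span` serves both to choose the next generator and to bound
  -- sumsets.
  record Independent (K m : ℕ) : Set (c ⊔ ℓ) where
    field
      x           : Fin m → Carrier
      nonzero     : ∀ i → ¬ x i ≈ ε
      span        : List Carrier
      span-cover  : ∀ a → (∀ i → a i ≤ K) → combination x a ∈ᴳ span
      independent : ∀ a b → (∀ i → a i ≤ K) → (∀ i → b i ≤ K) →
                    combination x a ≈ combination x b → ∀ i → a i ⋆ x i ≈ b i ⋆ x i

  -- The new generator is generic for all differences of `span`: a relation makes a multiple of it
  -- such a difference, so that multiple vanishes and the relation drops to the older generators.
  independent : ∀ K m → Independent K m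
  independent K zero = record
    { x = λ () ; nonzero = λ () ; span = ε ∷ [] ; span-cover = λ _ _ → here refl
    ; independent = λ _ _ _ _ _ () }
  independent K (suc m) with independent K m
  ... | I with generic (dichotomous K) (cartesianProductWith _//_ (Independent.span I) (Independent.span I))
  ...   | x₀ , x₀≉ε , vanish = record
    { x = x′
    ; nonzero = λ { zero → x₀≉ε ; (suc i) → nonzero i }
    ; span = cartesianProductWith (λ k g → k ⋆ x₀ ∙ g) (upTo (suc K)) span
    ; span-cover = λ a a≤K →
        Memₚ.∈-cartesianProductWith⁺ (≡.setoid ℕ) setoid setoid
          {f = λ k g → k ⋆ x₀ ∙ g} (λ k≡l g≈h → ∙-cong (×-congˡ k≡l) g≈h)
          (∈-upTo⁺ (s≤s (a≤K zero))) (span-cover (a ∘ suc) (a≤K ∘ suc))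
    ; independent = ind
    }
    where
    open Independent I renaming (independent to independent′)
    x′ : Fin (suc m) → Carrier
    x′ zero    = x₀
    x′ (suc i) = x i

    head : ∀ a b → (∀ i → a i ≤ K) → (∀ i → b i ≤ K) → combination x′ a ≈ combination x′ b →
           b zero ≤ a zero → a zero ⋆ x₀ ≈ b zero ⋆ x₀
    head a b a≤K b≤K eq b₀≤a₀ = begin
      a zero ⋆ x₀          ≡⟨ ≡.cong (_⋆ x₀) split ⟩
      (b zero + d) ⋆ x₀    ≈⟨ ×-homo-+ x₀ (b zero) d ⟩
      b zero ⋆ x₀ ∙ d ⋆ x₀ ≈⟨ ∙-congˡ dx₀≈ε ⟩
      b zero ⋆ x₀ ∙ ε      ≈⟨ identityʳ _ ⟩
      b zero ⋆ x₀          ∎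
      where
      d = a zero ∸ b zero
      split : a zero ≡ b zero + d
      split = ≡.sym (ℕ.m+[n∸m]≡n b₀≤a₀)
      ra = combination x (a ∘ suc)
      rb = combination x (b ∘ suc)
      d+ra≈rb : d ⋆ x₀ ∙ ra ≈ rb
      d+ra≈rb = ∙-cancelˡ (b zero ⋆ x₀) _ _ (begin
        b zero ⋆ x₀ ∙ (d ⋆ x₀ ∙ ra) ≈⟨ assoc _ _ _ ⟨
        b zero ⋆ x₀ ∙ d ⋆ x₀ ∙ ra   ≈⟨ ∙-congʳ (×-homo-+ x₀ (b zero) d) ⟨
        (b zero + d) ⋆ x₀ ∙ ra      ≡⟨ ≡.cong (λ k → k ⋆ x₀ ∙ ra) split ⟨
        a zero ⋆ x₀ ∙ ra            ≈⟨ eq ⟩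
        b zero ⋆ x₀ ∙ rb            ∎)
      dx₀≈rb-ra : d ⋆ x₀ ≈ rb // ra
      dx₀≈rb-ra = ∙-cancelʳ ra _ _ (trans d+ra≈rb (sym (//-rightDividesˡ ra rb)))
      dx₀≈ε : d ⋆ x₀ ≈ ε
      dx₀≈ε = vanish d (ℕ.≤-trans (ℕ.m∸n≤m (a zero) (b zero)) (a≤K zero))
        (Memₚ.∈-resp-≈ setoid (sym dx₀≈rb-ra)
          (Memₚ.∈-cartesianProductWith⁺ setoid setoid setoid
            (λ p q → ∙-cong p (⁻¹-cong q))
            (span-cover (b ∘ suc) (b≤K ∘ suc)) (span-cover (a ∘ suc) (a≤K ∘ suc))))

    ind : ∀ a b → (∀ i → a i ≤ K) → (∀ i → b i ≤ K) → combination x′ a ≈ combination x′ b →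
          ∀ i → a i ⋆ x′ i ≈ b i ⋆ x′ i
    ind a b a≤K b≤K eq = λ { zero → a₀≈b₀
      ; (suc i) → independent′ (a ∘ suc) (b ∘ suc) (a≤K ∘ suc) (b≤K ∘ suc)
          (∙-cancelˡ (a zero ⋆ x₀) _ _ (trans eq (∙-congʳ (sym a₀≈b₀)))) i }
      where
      a₀≈b₀ : a zero ⋆ x₀ ≈ b zero ⋆ x₀
      a₀≈b₀ with ℕ.≤-total (b zero) (a zero)
      ... | inj₁ b≤a = head a b a≤K b≤K eq b≤a
      ... | inj₂ a≤b = sym (head b a b≤K a≤K (sym eq) a≤b)

  module _ {K m} (I : Independent K m) where
    open Independent I renaming (independent to independent′)

    -- If `a i` were `suc (b i)`, cancelling `b i ⋆ x i` would leave `x i ≈ ε`.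
    coefficients-differ : ∀ {a b} → (∀ i → a i ≤ K) → (∀ i → b i ≤ K) →
      combination x a ≈ combination x b → ∀ i → a i ≢ suc (b i)
    coefficients-differ {a} {b} a≤K b≤K eq i ai≡1+bi = nonzero i (∙-cancelʳ (b i ⋆ x i) _ _ (begin
      suc (b i) ⋆ x i ≡⟨ ≡.cong (_⋆ x i) ai≡1+bi ⟨
      a i ⋆ x i       ≈⟨ independent′ a b a≤K b≤K eq i ⟩
      b i ⋆ x i       ≈⟨ identityˡ _ ⟨
      ε ∙ b i ⋆ x i   ∎))

[_] : ∀ {p} {P : Set p} → Dec P → ℕ
[ P? ] = if does P? then 1 else 0

[]-yes : ∀ {p} {P : Set p} (P? : Dec P) → P → [ P? ] ≡ 1
[]-yes P? p = cong (if_then 1 else 0) (dec-true P? p)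

[]-no : ∀ {p} {P : Set p} (P? : Dec P) → ¬ P → [ P? ] ≡ 0
[]-no P? ¬p = cong (if_then 1 else 0) (dec-false P? ¬p)

-- The configuration S, in coordinates

module Gadgets (n r : ℕ) (T : Fin n → List (Fin r)) where

  Colour : Set
  Colour = Fin n ⊎ Fin r

  pattern root c = inj₁ c
  pattern leaf j = inj₂ j

  _≟_ : DecidableEquality Colour
  _≟_ = Sum⊎.≡-dec Fin._≟_ Fin._≟_

  _≟²_ : DecidableEquality (Colour × Colour)
  _≟²_ = Product.≡-dec _≟_ _≟_

  Atom : Set
  Atom = ⊤ ⊎ (Colour ⊎ Colour × Colour)

  pattern axis     = inj₁ tt
  pattern colour i = inj₂ (inj₁ i)
  pattern link b   = inj₂ (inj₂ b)

  -- Independent generators are δ (axis), y i (colour i) and z i j (link (i , j)).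
  -- With e ∈ {−1, 0, 1}, the points are y i + eδ (core i), y i + z i j + eδ (up i j)
  -- and y j − z i j + eδ (dn i j); so up i j and dn i j add up to core i plus core j.
  -- To stay in ℕ all coefficients of δ and of the z's are raised by 1, which
  -- only translates every point by the same element. The r_c and t_j of the
  -- introduction are core (root c) and core (leaf j), both with e = 0.
  data Shape : Set where
    core  : Colour → Shape
    up dn : Colour → Colour → Shape

  hue : Shape → Colour
  hue (core i) = i
  hue (up i j) = i
  hue (dn i j) = j

  Point : Set
  Point = Shape × Fin 3

  hueₚ : Point → Colour
  hueₚ = hue ∘ proj₁

  linkage : Shape → Colour × Colour → ℕ
  linkage (core _) _ = 1
  linkage (up i j) b = 1 + [ (i , j) ≟² b ]
  linkage (dn i j) b = 1 ∸ [ (i , j) ≟² b ]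

  vec : Point → Atom → ℕ
  vec (σ , k) axis       = toℕ k
  vec (σ , k) (colour i) = [ hue σ ≟ i ]
  vec (σ , k) (link b)   = linkage σ b

  vec≤2 : ∀ s a → vec s a ≤ 2
  vec≤2 (σ , k) axis = ℕ.≤-pred (Fin.toℕ<n k)
  vec≤2 (σ , k) (colour i) with does (hue σ ≟ i)
  ... | true  = s≤s z≤n
  ... | false = z≤n
  vec≤2 (core i , _) (link b) = s≤s z≤n
  vec≤2 (up i j , _) (link b) with does ((i , j) ≟² b)
  ... | true  = ℕ.≤-refl
  ... | false = s≤s z≤n
  vec≤2 (dn i j , _) (link b) = ℕ.≤-trans (ℕ.m∸n≤m 1 [ (i , j) ≟² b ]) (s≤s z≤n)

  Σvec : List Point → Atom → ℕ
  Σvec L a = sum (map (λ s → vec s a) L)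

  Σvec≤ : ∀ L a → Σvec L a ≤ length L * 2
  Σvec≤ [] a = z≤n
  Σvec≤ (s ∷ L) a = ℕ.+-mono-≤ (vec≤2 s a) (Σvec≤ L a)

  Σvec-↭ : ∀ {L L′} → L ↭ L′ → Σvec L ≗ Σvec L′
  Σvec-↭ L↭L′ a = sum-↭ (Permₚ.map⁺ _ L↭L′)

  -- A pair of colours is bad when the sum of its two cores has to lie in 2S.
  data Bad : Colour → Colour → Set where
    roots : ∀ {c d} → Bad (root c) (root d)
    alien : ∀ {c j} → j ∉ T c → Bad (root c) (leaf j)
    twins : ∀ {j} → Bad (leaf j) (leaf j)

  -- A root core is present at offsets ±1 only and a leaf core at offset 0 only, so neither can
  -- absorb a change of offset; the auxiliary points occur at every offset and can.
  data InS : Point → Set where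
    near : ∀ {c k} → k ≢ 1F → InS (core (root c) , k)
    thin : ∀ {j} → InS (core (leaf j) , 1F)
    upper : ∀ {i j k} → Bad i j → InS (up i j , k)
    lower : ∀ {i j k} → Bad i j → InS (dn i j , k)

  centre : Fin n → Point
  centre c = core (root c) , 1F

  thins : List (Fin r) → List Point
  thins = map (λ j → core (leaf j) , 1F)

  data InA (cs : List (Fin n)) : Point → Set where
    base : ∀ {s} → InS s → InA cs s
    top  : ∀ {c} → c ∈ cs → InA cs (centre c)

  Admissible : Fin n → List (Fin r) → Set
  Admissible c p = Unique p × All (_∈ T c) p

  spike : Fin n → List (Fin r) → List Point
  spike c p = centre c ∷ thins p

  -- Rewriting sums inside hS

  Represented : ℕ → (Atom → ℕ) → Set
  Represented h v = ∃[ L ] All InS L × length L ≡ h × Σvec L ≗ v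

  private
    push : ∀ {s h v w} → InS s → (∀ a → w a ≡ vec s a + v a) → Represented h v → Represented (suc h) w
    push s∈S w≗ (L , L⊆S , eq , L≗v) =
      _ ∷ L , s∈S ∷ L⊆S , cong suc eq , λ a → ≡.trans (cong (_+_ (vec _ a)) (L≗v a)) (≡.sym (w≗ a))

    swap₂ : ∀ s t {L : List Point} → Σvec (s ∷ t ∷ L) ≗ Σvec (t ∷ s ∷ L)
    swap₂ s t {L} = Σvec-↭ {s ∷ t ∷ L} {t ∷ s ∷ L} (↭-swap s t ↭-refl)

    split : ∀ i j k l L → Σvec ((up i j , k) ∷ (dn i j , l) ∷ L) ≗ Σvec ((core i , k) ∷ (core j , l) ∷ L)
    split i j k l L axis       = ≡.refl
    split i j k l L (colour _) = ≡.refl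
    split i j k l L (link b) with does ((i , j) ≟² b)
    ... | true  = ≡.refl
    ... | false = ≡.refl

    exchange : ∀ σ ρ {k l k′ l′} L → toℕ k + toℕ l ≡ toℕ k′ + toℕ l′ →
               Σvec ((σ , k) ∷ (ρ , l) ∷ L) ≗ Σvec ((σ , k′) ∷ (ρ , l′) ∷ L)
    exchange σ ρ {k} {l} {k′} {l′} L eq axis = begin
      toℕ k + (toℕ l + s)    ≡⟨ ℕ.+-assoc (toℕ k) (toℕ l) s ⟨
      toℕ k + toℕ l + s      ≡⟨ cong (_+ s) eq ⟩
      toℕ k′ + toℕ l′ + s    ≡⟨ ℕ.+-assoc (toℕ k′) (toℕ l′) s ⟩
      toℕ k′ + (toℕ l′ + s)  ∎
      where
      open ≡-Reasoning
      s = Σvec L axis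
    exchange σ ρ L eq (colour _) = ≡.refl
    exchange σ ρ L eq (link _)   = ≡.refl

    off-centre : ∀ (k : Fin 3) → ∃[ k′ ] ∃[ l ] k′ ≢ 1F × toℕ {3} k′ + toℕ {3} l ≡ 1 + toℕ k
    off-centre 0F = 0F , 1F , (λ ()) , ≡.refl
    off-centre 1F = 0F , 2F , (λ ()) , ≡.refl
    off-centre 2F = 2F , 1F , (λ ()) , ≡.refl

    cover-pair : ∀ {i j k l L} → Bad i j → All InS L →
                 Represented (2 + length L) (Σvec ((core i , k) ∷ (core j , l) ∷ L))
    cover-pair {i} {j} {k} {l} {L} b L⊆S =
      _ , upper b ∷ lower b ∷ L⊆S , ≡.refl , split i j k l L

    -- Only the total offset matters, so a companion free to take any offset lets the missing centre
    -- move to offset ±1, where it belongs to S.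
    recentre : ∀ {c σ k L} → (∀ {l} → InS (σ , l)) → All InS L →
               Represented (2 + length L) (Σvec (centre c ∷ (σ , k) ∷ L))
    recentre {c} {σ} {k} {L} σ∈S L⊆S with k′ , l , k′≢1 , eq ← off-centre k =
      _ , near k′≢1 ∷ σ∈S ∷ L⊆S , ≡.refl , exchange (core (root c)) σ L eq

    thins⊆S : ∀ p → All InS (thins p)
    thins⊆S []      = []
    thins⊆S (j ∷ p) = thin ∷ thins⊆S p

  open DecMembership (Fin._≟_ {r}) using (_∈?_)

  -- A second root core or a leaf outside `T c` forms a bad pair with the centre; an auxiliary point
  -- allows recentring; a repeated leaf is a bad pair with itself. Otherwise the rest is a set of
  -- leaves from `T c`.
  absorb : ∀ c {L} → All InS L → Represented (suc (length L)) (Σvec (centre c ∷ L)) ⊎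
           (∃[ p ] L ≡ thins p × Admissible c p)
  absorb c [] = inj₂ ([] , ≡.refl , [] , [])
  absorb c (near _ ∷ L⊆S) = inj₁ (cover-pair roots L⊆S)
  absorb c (upper b ∷ L⊆S) = inj₁ (recentre (upper b) L⊆S)
  absorb c (lower b ∷ L⊆S) = inj₁ (recentre (lower b) L⊆S)
  absorb c {_ ∷ L} (thin {j} ∷ L⊆S) with j ∈? T c | absorb c L⊆S
  ... | no j∉T | _ = inj₁ (cover-pair (alien j∉T) L⊆S)
  ... | yes _ | inj₁ rep = inj₁ (push thin (swap₂ (centre c) (core (leaf j) , 1F) {L}) rep)
  ... | yes j∈T | inj₂ (p , ≡.refl , p! , p⊆T) with j ∈? p
  ...   | no j∉p = inj₂ (j ∷ p , ≡.refl , Allₚ.¬Any⇒All¬ p j∉p ∷ p! , j∈T ∷ p⊆T)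
  -- The two copies of `j` become an `up` and a `dn`, and the offsets 1, 1, 1 are redistributed as
  -- 0, 2, 1 to take the centre into S.
  ...   | yes j∈p with q , p↭ ← ∈⇒↭ j∈p =
    inj₁ (_ , near {c} {0F} (λ ()) ∷ upper {k = 2F} twins ∷ lower {k = 1F} twins ∷ thins⊆S q ,
      cong (_+_ 2) (Permₚ.↭-length (↭-sym thins↭)) , λ a → begin
        Σvec ((core (root c) , 0F) ∷ (up (leaf j) (leaf j) , 2F) ∷ rest) a
          ≡⟨ exchange (core (root c)) (up (leaf j) (leaf j)) rest ≡.refl a ⟩
        Σvec (centre c ∷ (up (leaf j) (leaf j) , 1F) ∷ rest) a
          ≡⟨ cong (_+_ (vec (centre c) a)) (split (leaf j) (leaf j) 1F 1F (thins q) a) ⟩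
        Σvec (centre c ∷ thins (j ∷ j ∷ q)) a
          ≡⟨ Σvec-↭ (prep _ (prep _ (↭-sym thins↭))) a ⟩
        Σvec (centre c ∷ thins (j ∷ p)) a ∎)
    where
    open ≡-Reasoning
    rest = (dn (leaf j) (leaf j) , 1F) ∷ thins q
    thins↭ : thins p ↭ thins (j ∷ q)
    thins↭ = Permₚ.map⁺ _ p↭

  Spiked : List (Fin n) → List Point → Set
  Spiked cs L = ∃[ c ] ∃[ p ] c ∈ cs × Admissible c p × length L ≡ suc (length p) × Σvec L ≗ Σvec (spike c p)

  -- Summands are added one at a time, so at most one centre is ever carried along.
  expand : ∀ {cs L} → All (InA cs) L → Represented (length L) (Σvec L) ⊎ Spiked cs L
  expand [] = inj₁ ([] , [] , ≡.refl , λ _ → ≡.refl)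
  expand {cs} {s ∷ L} (s∈A ∷ L⊆A) with s∈A | expand L⊆A
  ... | base s∈S | inj₁ rep = inj₁ (push s∈S (λ _ → ≡.refl) rep)
  ... | top {c} c∈cs | inj₁ (L′ , L′⊆S , eq , L′≗L) with absorb c L′⊆S
  ...   | inj₁ (L″ , L″⊆S , eq′ , L″≗) =
    inj₁ (L″ , L″⊆S , ≡.trans eq′ (cong suc eq) , λ a → ≡.trans (L″≗ a) (cong (_+_ (vec (centre c) a)) (L′≗L a)))
  ...   | inj₂ (p , ≡.refl , adm) =
    inj₂ (c , p , c∈cs , adm , cong suc (≡.trans (≡.sym eq) (length-map _ p)) ,
          λ a → cong (_+_ (vec (centre c) a)) (≡.sym (L′≗L a)))
  expand {cs} {s ∷ L} (s∈A ∷ L⊆A) | base s∈S | inj₂ (c , p , c∈cs , adm , eq , L≗)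
    with absorb c (s∈S ∷ thins⊆S p)
  ... | inj₁ (L″ , L″⊆S , eq′ , L″≗) =
    inj₁ (L″ , L″⊆S , ≡.trans eq′ (cong suc (≡.trans (cong suc (length-map _ p)) (≡.sym eq))) ,
          λ a → ≡.trans (L″≗ a) (rotate a))
    where
    rotate : ∀ a → Σvec (centre c ∷ s ∷ thins p) a ≡ Σvec (s ∷ L) a
    rotate a = ≡.trans (swap₂ (centre c) s {thins p} a) (cong (_+_ (vec s a)) (≡.sym (L≗ a)))
  ... | inj₂ (q , sp≡q , adm′) =
    inj₂ (c , q , c∈cs , adm′ , cong suc (≡.trans eq (≡.trans (cong suc (≡.sym (length-map _ p)))
            (≡.trans (cong length sp≡q) (length-map _ q)))) ,
          λ a → ≡.trans (cong (_+_ (vec s a)) (L≗ a)) (≡.trans (swap₂ s (centre c) {thins p} a)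
            (cong (λ M → Σvec (centre c ∷ M) a) sp≡q)))
  -- Two centres form a bad pair of roots, so together they are rewritten inside S.
  expand {cs} {s ∷ L} (s∈A ∷ L⊆A) | top {d} d∈cs | inj₂ (c , p , c∈cs , adm , eq , L≗)
    with cover-pair {root d} {root c} {1F} {1F} roots (thins⊆S p)
  ... | L″ , L″⊆S , eq′ , L″≗ =
    inj₁ (L″ , L″⊆S , ≡.trans eq′ (cong suc (≡.trans (cong suc (length-map _ p)) (≡.sym eq))) ,
          λ a → ≡.trans (L″≗ a) (cong (_+_ (vec (centre d) a)) (≡.sym (L≗ a))))

  spike⊆A : ∀ {cs c} p → c ∈ cs → All (InA cs) (spike c p)
  spike⊆A p c∈cs = top c∈cs ∷ All.map base (thins⊆S p)

  -- Separating spikes from hS by coefficients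

  -- Over independent generators, vectors of equal value are Close both ways.
  Close : (v w : Atom → ℕ) → Set
  Close v w = ∀ a → v a ≢ suc (w a)

  hues : Fin n → List (Fin r) → List Colour
  hues c p = map hueₚ (spike c p)

  leaf∈hues : ∀ {c j} p → leaf j ∈ hues c p → j ∈ p
  leaf∈hues (i ∷ p) (there (here ≡.refl)) = here ≡.refl
  leaf∈hues {c} (i ∷ p) (there (there j∈)) = there (leaf∈hues {c} p (there j∈))

  root∈hues : ∀ {c d} p → root d ∈ hues c p → d ≡ c
  root∈hues p (here ≡.refl) = ≡.refl
  root∈hues (_ ∷ p) (there (there d∈)) = root∈hues p (there d∈)

  hues-unique : ∀ {c p} → Unique p → Unique (hues c p)
  hues-unique {c} {p} p! = Allₚ.¬Any⇒All¬ _ (λ r∈ → no-root p r∈) ∷ leaves p!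
    where
    no-root : ∀ p → root c ∉ map hueₚ (thins p)
    no-root (_ ∷ p) (there r∈) = no-root p r∈
    leaves : ∀ {p} → Unique p → Unique (map hueₚ (thins p))
    leaves [] = []
    leaves {j ∷ p} (j∉p ∷ p!) = Allₚ.¬Any⇒All¬ _
      (λ j∈ → Allₚ.All¬⇒¬Any j∉p (leaf∈hues {c} p (there j∈))) ∷ leaves p!

  -- A spike has one root and only leaves from `T c`, which excludes every bad pair of different
  -- colours.
  bad-hues : ∀ {c p i j} → All (_∈ T c) p → i ∈ hues c p → j ∈ hues c p → Bad i j → i ≡ j
  bad-hues {p = p} p⊆T i∈ j∈ roots = cong root (≡.trans (root∈hues p i∈) (≡.sym (root∈hues p j∈)))
  bad-hues {c} {p} p⊆T i∈ j∈ (alien j∉T) with ≡.refl ← root∈hues {c} p i∈ =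
    ⊥-elim (j∉T (All.lookup p⊆T (leaf∈hues {c} p j∈)))
  bad-hues p⊆T i∈ j∈ twins = ≡.refl

  absent-colour : ∀ {i} L → i ∉ map hueₚ L → Σvec L (colour i) ≡ 0
  absent-colour [] i∉ = ≡.refl
  absent-colour {i} ((σ , k) ∷ L) i∉ =
    cong₂ _+_ ([]-no (hue σ ≟ i) (λ eq → i∉ (here (≡.sym eq)))) (absent-colour L (i∉ ∘ there))

  present-colour : ∀ {i L} → Unique (map hueₚ L) → i ∈ map hueₚ L → Σvec L (colour i) ≡ 1
  present-colour {i} {(σ , k) ∷ L} (s∉ ∷ L!) (here ≡.refl) =
    cong₂ _+_ ([]-yes (hue σ ≟ i) ≡.refl) (absent-colour L (Allₚ.All¬⇒¬Any s∉))
  present-colour {i} {(σ , k) ∷ L} (s∉ ∷ L!) (there i∈) =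
    cong₂ _+_ ([]-no (hue σ ≟ i) (λ { ≡.refl → Allₚ.All¬⇒¬Any s∉ i∈ })) (present-colour L! i∈)

  all-ones : ∀ {a L} → All (λ s → vec s a ≡ 1) L → Σvec L a ≡ length L
  all-ones []             = ≡.refl
  all-ones {a} (s₁ ∷ L₁) = cong₂ _+_ s₁ (all-ones {a} L₁)

  spike-axis : ∀ c p → Σvec (spike c p) axis ≡ suc (length p)
  spike-axis c p = cong suc (≡.trans (all-ones {axis} (Allₚ.map⁺ (All.universal (λ _ → ≡.refl) p)))
                                  (length-map _ p))

  spike-link : ∀ c p b → Σvec (spike c p) (link b) ≡ suc (length p)
  spike-link c p b = cong suc (≡.trans (all-ones {link b} (Allₚ.map⁺ (All.universal (λ _ → ≡.refl) p)))
                                    (length-map _ p))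

  colours-covered : ∀ {c p L} → Unique p → Close (Σvec (spike c p)) (Σvec L) →
                    All (_∈ map hueₚ L) (hues c p)
  colours-covered {c} {p} {L} p! close = All.tabulate found
    where
    open DecMembership _≟_ using () renaming (_∈?_ to _∈ᶜ?_)
    found : ∀ {i} → i ∈ hues c p → i ∈ map hueₚ L
    found {i} i∈ with i ∈ᶜ? map hueₚ L
    ... | yes i∈L = i∈L
    ... | no i∉L = ⊥-elim (close (colour i)
      (≡.trans (present-colour {L = spike c p} (hues-unique p!) i∈) (cong suc (≡.sym (absent-colour L i∉L)))))

  spike-injective : ∀ {c p d q} → Unique p → Close (Σvec (spike c p)) (Σvec (spike d q)) →
                    c ≡ d × (∀ {j} → j ∈ p → j ∈ q)
  spike-injective {c} {p} {d} {q} p! close =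
    root∈hues q (All.lookup covered (here ≡.refl)) ,
    λ j∈p → leaf∈hues {d} q (All.lookup covered (there (∈-map⁺ hueₚ (∈-map⁺ _ j∈p))))
    where
    covered = colours-covered {L = spike d q} p! close

  -- `L` must carry the colours of the spike, once each. An auxiliary point would shift its link
  -- coefficient alone, its partner being excluded by colour. So the point coloured `root c` is a
  -- root core at offset ±1, all others are leaf cores at offset 0, and the axis coefficient is off
  -- by 1.
  avoid : ∀ {c p L} → Admissible c p → All InS L → length L ≡ suc (length p) →
          Close (Σvec L) (Σvec (spike c p)) → Close (Σvec (spike c p)) (Σvec L) → ⊥
  avoid {c} {p} {L} (p! , p⊆T) L⊆S |L| close close′ = off (∈-map⁻ hueₚ root∈L)
    where
    -- A colour missing from L would have coefficient 0 against 1 in the spike.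
    hues↭ : hues c p ↭ map hueₚ L
    hues↭ = pigeonhole (hues-unique p!) (colours-covered p! close′)
      (≡.trans (≡.trans (length-map hueₚ (spike c p)) (cong suc (length-map _ p)))
        (≡.sym (≡.trans (length-map hueₚ L) |L|)))

    root∈L : root c ∈ map hueₚ L
    root∈L = Permₚ.∈-resp-↭ hues↭ (here ≡.refl)

    -- Every spike has coefficient h = 1 + |p| at each axis or link atom, so such
    -- an atom cannot be shifted by just one of the h summands in L.
    no-lone : ∀ {s L′} a → L ↭ s ∷ L′ → Σvec (spike c p) a ≡ suc (length p) →
              vec s a ≢ 1 → All (λ t → vec t a ≡ 1) L′ → ⊥
    no-lone {s} {L′} a L↭ spike≡ s≢1 ones = differ (vec s a) s≢1 total (vec≤2 s a)
      where
      |L′| : length L′ ≡ length p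
      |L′| = ℕ.suc-injective (≡.trans (≡.sym (Permₚ.↭-length L↭)) |L|)
      total : Σvec L a ≡ vec s a + length p
      total = ≡.trans (Σvec-↭ L↭ a) (cong (_+_ (vec s a)) (≡.trans (all-ones {a} ones) |L′|))
      differ : ∀ v → v ≢ 1 → Σvec L a ≡ v + length p → v ≤ 2 → ⊥
      differ 0 _ eq _ = close′ a (≡.trans spike≡ (cong suc (≡.sym eq)))
      differ 1 v≢1 _ _ = v≢1 ≡.refl
      differ 2 _ eq _ = close a (≡.trans eq (cong suc (≡.sym spike≡)))
      differ (suc (suc (suc _))) _ _ (s≤s (s≤s ()))

    module Split {s L′} (L↭ : L ↭ s ∷ L′) where
      other-hues : ∀ {t} → t ∈ L′ → hueₚ s ≢ hueₚ t
      other-hues t∈ eq with s∉ ∷ _ ← unique-↭ (↭-trans hues↭ (Permₚ.map⁺ hueₚ L↭)) (hues-unique {c} p!) =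
        All.lookup s∉ (∈-map⁺ hueₚ t∈) eq
      other-in-S : ∀ {t} → t ∈ L′ → InS t
      other-in-S t∈ = All.lookup L⊆S (Permₚ.∈-resp-↭ (↭-sym L↭) (there t∈))
      other-in-hues : ∀ {t} → t ∈ s ∷ L′ → hueₚ t ∈ hues c p
      other-in-hues t∈ = Permₚ.∈-resp-↭ (↭-sym hues↭) (∈-map⁺ hueₚ (Permₚ.∈-resp-↭ (↭-sym L↭) t∈))

    no-upper : ∀ {i j k} → Bad i j → (up i j , k) ∉ L
    no-upper {i} {j} bad u∈ with L′ , L↭ ← ∈⇒↭ u∈ = no-lone (link (i , j)) L↭ (spike-link c p _)
      (λ eq → case ≡.trans (≡.sym (cong suc ([]-yes ((i , j) ≟² (i , j)) ≡.refl))) eq of λ ())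
      (All.tabulate one)
      where
      open Split L↭
      one : ∀ {t} → t ∈ L′ → vec t (link (i , j)) ≡ 1
      one {core _ , _} t∈ = ≡.refl
      one {up i′ j′ , _} t∈ = cong suc ([]-no ((i′ , j′) ≟² (i , j)) λ { ≡.refl → other-hues t∈ ≡.refl })
      -- The partner has hue `j`; both `i` and `j` are hues of the spike, so they coincide and one
      -- hue would occur twice.
      one {dn i′ j′ , _} t∈ = cong (1 ∸_) ([]-no ((i′ , j′) ≟² (i , j)) λ { ≡.refl →
        other-hues t∈ (bad-hues {c} p⊆T (other-in-hues (here ≡.refl)) (other-in-hues (there t∈)) bad) })

    no-lower : ∀ {i j k} → Bad i j → (dn i j , k) ∉ L
    no-lower {i} {j} bad u∈ with L′ , L↭ ← ∈⇒↭ u∈ = no-lone (link (i , j)) L↭ (spike-link c p _)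
      (λ eq → case ≡.trans (≡.sym (cong (1 ∸_) ([]-yes ((i , j) ≟² (i , j)) ≡.refl))) eq of λ ())
      (All.tabulate one)
      where
      open Split L↭
      one : ∀ {t} → t ∈ L′ → vec t (link (i , j)) ≡ 1
      one {core _ , _} t∈ = ≡.refl
      one {dn i′ j′ , _} t∈ = cong (1 ∸_) ([]-no ((i′ , j′) ≟² (i , j)) λ { ≡.refl → other-hues t∈ ≡.refl })
      one {up i′ j′ , _} t∈ = cong suc ([]-no ((i′ , j′) ≟² (i , j)) λ { ≡.refl →
        other-hues t∈ (≡.sym (bad-hues {c} p⊆T (other-in-hues (there t∈)) (other-in-hues (here ≡.refl)) bad)) })

    off : ∃[ s ] s ∈ L × root c ≡ hueₚ s → ⊥
    off (s , s∈L , eq) with All.lookup L⊆S s∈L | eq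
    ... | upper b | _ = no-upper b s∈L
    ... | lower b | _ = no-lower b s∈L
    ... | near k≢1 | ≡.refl with L′ , L↭ ← ∈⇒↭ s∈L =
      no-lone axis L↭ (spike-axis c p) (k≢1 ∘ Fin.toℕ-injective) (All.tabulate one)
      where
      open Split L↭
      one : ∀ {t} → t ∈ L′ → vec t axis ≡ 1
      one t∈ with other-in-S t∈
      ... | upper b = ⊥-elim (no-upper b (Permₚ.∈-resp-↭ (↭-sym L↭) (there t∈)))
      ... | lower b = ⊥-elim (no-lower b (Permₚ.∈-resp-↭ (↭-sym L↭) (there t∈)))
      ... | thin = ≡.refl
      ... | near _ = ⊥-elim (other-hues t∈ (cong root (≡.sym (root∈hues p (other-in-hues (there t∈))))))

-- Counting

module _ {a} {A : Set a} where

  choose : ℕ → List A → List (List A)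
  choose zero    ts       = [] ∷ []
  choose (suc k) []       = []
  choose (suc k) (t ∷ ts) = map (t ∷_) (choose k ts) ++ choose (suc k) ts

  length-choose : ∀ k ts → length (choose k ts) ≡ length ts C k
  length-choose zero    ts       = ≡.refl
  length-choose (suc k) []       = ≡.sym (k>n⇒nCk≡0 {0} {suc k} (s≤s z≤n))
  length-choose (suc k) (t ∷ ts) = begin
    length (map (t ∷_) (choose k ts) ++ choose (suc k) ts)
      ≡⟨ length-++ (map (t ∷_) (choose k ts)) ⟩
    length (map (t ∷_) (choose k ts)) + length (choose (suc k) ts)
      ≡⟨ cong₂ _+_ (≡.trans (length-map _ (choose k ts)) (length-choose k ts)) (length-choose (suc k) ts) ⟩
    length ts C k + length ts C suc k
      ≡⟨ nCk+nC[k+1]≡[n+1]C[k+1] (length ts) k ⟩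
    suc (length ts) C suc k ∎
    where open ≡-Reasoning

  choose⁻ : ∀ k {ts p} → Unique ts → p ∈ choose k ts → Unique p × All (_∈ ts) p × length p ≡ k
  choose⁻ zero ts! (here ≡.refl) = [] , [] , ≡.refl
  choose⁻ (suc k) {t ∷ ts} (t∉ts ∷ ts!) p∈ with ∈-++⁻ (map (t ∷_) (choose k ts)) p∈
  ... | inj₂ p∈ʳ with p! , p⊆ , |p| ← choose⁻ (suc k) ts! p∈ʳ = p! , All.map there p⊆ , |p|
  ... | inj₁ p∈ˡ with q , q∈ , ≡.refl ← ∈-map⁻ (t ∷_) p∈ˡ with q! , q⊆ , |q| ← choose⁻ k ts! q∈ =
    All.map (All.lookup t∉ts) q⊆ ∷ q! , here ≡.refl ∷ All.map there q⊆ , cong suc |q|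

  choose-unique : ∀ k {ts} → Unique ts → Unique (choose k ts)
  choose-unique zero              ts!          = [] ∷ []
  choose-unique (suc k) {[]}      ts!          = []
  choose-unique (suc k) {t ∷ ts} (t∉ts ∷ ts!) =
    Uniqueₚ.++⁺ (Uniqueₚ.map⁺ ∷-injectiveʳ (choose-unique k ts!)) (choose-unique (suc k) ts!) disjoint
    where
    disjoint : ∀ {p} → ¬ (p ∈ map (t ∷_) (choose k ts) × p ∈ choose (suc k) ts)
    disjoint (p∈ˡ , p∈ʳ) with q , q∈ , ≡.refl ← ∈-map⁻ (t ∷_) p∈ˡ with _ , t∈ts ∷ _ , _ ← choose⁻ (suc k) ts! p∈ʳ =
      All.lookup t∉ts t∈ts ≡.refl

  -- Chosen sublists inherit the order of `ts`, so each is determined by its set of entries.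
  choose-injective : ∀ k {ts p q} → Unique ts → p ∈ choose k ts → q ∈ choose k ts →
                     (∀ {j} → j ∈ p → j ∈ q) → (∀ {j} → j ∈ q → j ∈ p) → p ≡ q
  choose-injective zero ts! (here ≡.refl) (here ≡.refl) p⊆q q⊆p = ≡.refl
  choose-injective (suc k) {t ∷ ts} (t∉ts ∷ ts!) p∈ q∈ p⊆q q⊆p
    with ∈-++⁻ (map (t ∷_) (choose k ts)) p∈ | ∈-++⁻ (map (t ∷_) (choose k ts)) q∈
  ... | inj₂ p∈ʳ | inj₂ q∈ʳ = choose-injective (suc k) ts! p∈ʳ q∈ʳ p⊆q q⊆p
  ... | inj₁ p∈ˡ | inj₂ q∈ʳ with _ , _ , ≡.refl ← ∈-map⁻ (t ∷_) p∈ˡ | _ , q⊆ , _ ← choose⁻ (suc k) ts! q∈ʳ =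
    ⊥-elim (All.lookup t∉ts (All.lookup q⊆ (p⊆q (here ≡.refl))) ≡.refl)
  ... | inj₂ p∈ʳ | inj₁ q∈ˡ with _ , _ , ≡.refl ← ∈-map⁻ (t ∷_) q∈ˡ | _ , p⊆ , _ ← choose⁻ (suc k) ts! p∈ʳ =
    ⊥-elim (All.lookup t∉ts (All.lookup p⊆ (q⊆p (here ≡.refl))) ≡.refl)
  ... | inj₁ p∈ˡ | inj₁ q∈ˡ
    with p , p∈′ , ≡.refl ← ∈-map⁻ (t ∷_) p∈ˡ | q , q∈′ , ≡.refl ← ∈-map⁻ (t ∷_) q∈ˡ =
    cong (t ∷_) (choose-injective k ts! p∈′ q∈′ (tail p∈′ p⊆q) (tail q∈′ q⊆p))
    where
    tail : ∀ {p q} → p ∈ choose k ts → (∀ {j} → j ∈ t ∷ p → j ∈ t ∷ q) → ∀ {j} → j ∈ p → j ∈ q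
    tail p∈ p⊆q j∈p with p⊆q (there j∈p)
    ... | there j∈q = j∈q
    ... | here ≡.refl with _ , p⊆ , _ ← choose⁻ k ts! p∈ =
      ⊥-elim (All.lookup t∉ts (All.lookup p⊆ j∈p) ≡.refl)

  module _ (_≟_ : DecidableEquality A) where
    open DecMembership _≟_ using (_∈?_)

    -- Walking along `ts` and extracting each entry found in `p` sorts `p` into the order of `ts`.
    choose⁺ : ∀ {ts p} → Unique p → All (_∈ ts) p → ∃[ q ] q ∈ choose (length p) ts × p ↭ q
    choose⁺ {p = []} p! p⊆ = [] , here ≡.refl , ↭-refl
    choose⁺ {[]} {_ ∷ _} p! (() ∷ _)
    choose⁺ {t ∷ ts} {p@(_ ∷ _)} p! p⊆ with t ∈? p
    ... | no t∉p =
      let q , q∈ , p↭q = choose⁺ p! (All.tabulate λ j∈p → strip (λ { ≡.refl → t∉p j∈p }) (All.lookup p⊆ j∈p)) in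
      q , ∈-++⁺ʳ _ q∈ , p↭q
      where
      strip : ∀ {j} → j ≢ t → j ∈ t ∷ ts → j ∈ ts
      strip j≢t (here j≡t) = ⊥-elim (j≢t j≡t)
      strip j≢t (there j∈) = j∈
    ... | yes t∈p with p′ , p↭ ← ∈⇒↭ t∈p with t∉p′ ∷ p′! ← unique-↭ p↭ p! =
      let q , q∈ , p′↭q = choose⁺ p′! (All.tabulate λ j∈ → strip (All.lookup t∉p′ j∈)
                            (All.lookup p⊆ (Permₚ.∈-resp-↭ (↭-sym p↭) (there j∈)))) in
      t ∷ q ,
      ∈-++⁺ˡ (∈-map⁺ (t ∷_) (≡.subst (λ k → q ∈ choose k ts)
        (ℕ.suc-injective (≡.sym (Permₚ.↭-length p↭))) q∈)) ,
      ↭-trans p↭ (prep t p′↭q)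
      where
      strip : ∀ {j} → t ≢ j → j ∈ t ∷ ts → j ∈ ts
      strip t≢j (here j≡t) = ⊥-elim (t≢j (≡.sym j≡t))
      strip t≢j (there j∈) = j∈

-- Integer combinations of the rows of Pascal's triangle

binomials : List ℕ → ℕ → ℕ
binomials Ds k = sum (map (_C k) Ds)

binomials-++ : ∀ P Q k → binomials (P ++ Q) k ≡ binomials P k + binomials Q k
binomials-++ P Q k = ≡.trans (cong sum (map-++ (_C k) P Q)) (sum-++ (map (_C k) P) (map (_C k) Q))

binomials-replicate : ∀ a H → binomials (replicate a H) H ≡ a
binomials-replicate zero    H = ≡.refl
binomials-replicate (suc a) H = cong₂ _+_ (nCn≡1 H) (binomials-replicate a H)

binomials-small : ∀ {P k} → All (_< k) P → binomials P k ≡ 0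
binomials-small []           = ≡.refl
binomials-small (D<k ∷ P<k) = cong₂ _+_ (k>n⇒nCk≡0 D<k) (binomials-small P<k)

gap : List ℕ → List ℕ → ℕ → ℤ
gap P Q k = + binomials P k - + binomials Q k

gap-++ : ∀ P P′ Q Q′ k → gap (P ++ P′) (Q ++ Q′) k ≡ gap P Q k ℤ.+ gap P′ Q′ k
gap-++ P P′ Q Q′ k rewrite binomials-++ P P′ k | binomials-++ Q Q′ k
  | ℤ.pos-+ (binomials P k) (binomials P′ k) | ℤ.pos-+ (binomials Q k) (binomials Q′ k) =
  regroup (+ binomials P k) (+ binomials P′ k) (+ binomials Q k) (+ binomials Q′ k)
  where
  regroup : ∀ p p′ q q′ → (p ℤ.+ p′) - (q ℤ.+ q′) ≡ (p - q) ℤ.+ (p′ - q′)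
  regroup = solve-∀

gap-top : ∀ H z → ∃[ P ] ∃[ Q ] All (_< suc H) P × All (_< suc H) Q × gap P Q H ≡ z
gap-top H (+ a) = replicate a H , [] , Allₚ.replicate⁺ a ℕ.≤-refl , [] ,
  ≡.trans (ℤ.+-identityʳ _) (cong +_ (binomials-replicate a H))
gap-top H -[1+ a ] = [] , replicate (suc a) H , [] , Allₚ.replicate⁺ (suc a) ℕ.≤-refl ,
  ≡.trans (ℤ.+-identityˡ _) (cong (λ b → ℤ.- (+ b)) (binomials-replicate (suc a) H))

-- Back substitution from the top: copies of row `H` fix the value at `H`, and the lower targets are
-- corrected for their effect. The rows added afterwards are below `H` and vanish there.
gap-surjective : ∀ H (m : ℕ → ℤ) → ∃[ P ] ∃[ Q ] All (_< H) P × All (_< H) Q ×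
                 (∀ k → k < H → gap P Q k ≡ m k)
gap-surjective zero    m = [] , [] , [] , [] , λ _ ()
gap-surjective (suc H) m with P , Q , P≤H , Q≤H , top ← gap-top H (m H)
  with P′ , Q′ , P′<H , Q′<H , rest ← gap-surjective H (λ k → m k - gap P Q k) =
  P ++ P′ , Q ++ Q′ , Allₚ.++⁺ P≤H (All.map ℕ.m<n⇒m<1+n P′<H) , Allₚ.++⁺ Q≤H (All.map ℕ.m<n⇒m<1+n Q′<H) ,
  λ k k<1+H → ≡.trans (gap-++ P P′ Q Q′ k) (solved k (ℕ.m<1+n⇒m<n∨m≡n k<1+H))
  where
  cancel : ∀ x y → x ℤ.+ (y - x) ≡ y
  cancel = solve-∀
  solved : ∀ k → k < H ⊎ k ≡ H → gap P Q k ℤ.+ gap P′ Q′ k ≡ m k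
  solved k (inj₁ k<H) = ≡.trans (cong (ℤ._+_ (gap P Q k)) (rest k k<H)) (cancel (gap P Q k) (m k))
  solved k (inj₂ ≡.refl) = ≡.trans (cong₂ ℤ._+_ top
    (cong₂ (λ a b → + a - + b) (binomials-small P′<H) (binomials-small Q′<H))) (ℤ.+-identityʳ (m H))

-- Enumerating the spikes

module Spikes (n r : ℕ) (T : Fin n → List (Fin r)) (T! : ∀ c → Unique (T c)) where

  spikes : ℕ → List (Fin n) → List (Fin n × List (Fin r))
  spikes k []       = []
  spikes k (c ∷ cs) = map (c ,_) (choose k (T c)) ++ spikes k cs

  ∈-spikes⁺ : ∀ {k cs c p} → c ∈ cs → p ∈ choose k (T c) → (c , p) ∈ spikes k cs
  ∈-spikes⁺ (here ≡.refl) p∈ = ∈-++⁺ˡ (∈-map⁺ _ p∈)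
  ∈-spikes⁺ (there c∈)    p∈ = ∈-++⁺ʳ _ (∈-spikes⁺ c∈ p∈)

  ∈-spikes⁻ : ∀ {k} cs {c p} → (c , p) ∈ spikes k cs → c ∈ cs × p ∈ choose k (T c)
  ∈-spikes⁻ {k} (c ∷ cs) cp∈ with ∈-++⁻ (map (c ,_) (choose k (T c))) cp∈
  ... | inj₁ l with _ , p∈ , ≡.refl ← ∈-map⁻ _ l = here ≡.refl , p∈
  ... | inj₂ r with c∈ , p∈ ← ∈-spikes⁻ cs r = there c∈ , p∈

  spikes-unique : ∀ k {cs} → Unique cs → Unique (spikes k cs)
  spikes-unique k [] = []
  spikes-unique k {c ∷ cs} (c∉cs ∷ cs!) =
    Uniqueₚ.++⁺ (Uniqueₚ.map⁺ ,-injectiveʳ (choose-unique k (T! c))) (spikes-unique k cs!) disjoint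
    where
    disjoint : ∀ {cp} → ¬ (cp ∈ map (c ,_) (choose k (T c)) × cp ∈ spikes k cs)
    disjoint (l , r) with _ , _ , ≡.refl ← ∈-map⁻ _ l =
      All.lookup c∉cs (proj₁ (∈-spikes⁻ cs r)) ≡.refl

  length-spikes : ∀ k cs → length (spikes k cs) ≡ binomials (map (length ∘ T) cs) k
  length-spikes k [] = ≡.refl
  length-spikes k (c ∷ cs) = ≡.trans (length-++ (map (c ,_) (choose k (T c))))
    (cong₂ _+_ (≡.trans (length-map _ (choose k (T c))) (length-choose k (T c))) (length-spikes k cs))

-- Transfer to the group

module Realisation {c ℓ} (em : ExcludedMiddle (c ⊔ ℓ)) (G : AbelianGroup c ℓ)
                   (G-infinite : Sumsets.Infinite G) (H : ℕ)
                   (n : ℕ) (T : Fin n → List (Fin H)) (T! : ∀ i → Unique (T i)) where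

  open AbelianGroup G
  open GroupProperties group using (∙-cancelˡ)
  open Sumsets G
  open Finiteness em G
  open Freeness em G G-infinite
  open Gadgets n H T
  open Spikes n H T T!
  open Membership setoid using () renaming (_∈_ to _∈ᴳ_)
  open UniqueSetoid setoid using () renaming (Unique to Uniqueᴳ)
  open SetoidReasoning setoid

  private
    N : ℕ
    N = 1 + ((n + H) + (n + H) * (n + H))

    atoms : Fin N ↔ Atom
    atoms = (Fin.1↔⊤ ⊎-↔ ((Fin.+↔⊎ ⊎-↔ ((Fin.+↔⊎ ×-↔ Fin.+↔⊎) ↔-∘ Fin.*↔×)) ↔-∘ Fin.+↔⊎)) ↔-∘ Fin.+↔⊎
    open Inverse atoms using (to; from; strictlyInverseˡ)

    -- Coordinates of a point are at most 2, so sums of at most `H` points have coefficients at most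
    -- `H * 2`.
    I : Independent (H * 2) N
    I = independent (H * 2) N
    open Independent I using (x; span; span-cover)

  φ : (Atom → ℕ) → Carrier
  φ v = combination x (v ∘ to)

  φ-cong : ∀ {v w} → v ≗ w → φ v ≈ φ w
  φ-cong v≗w = combination-cong x (v≗w ∘ to)

  φ-+ : ∀ v w → φ (λ a → v a + w a) ≈ φ v ∙ φ w
  φ-+ v w = combination-+ x (v ∘ to) (w ∘ to)

  φ-0 : φ (λ _ → 0) ≈ ε
  φ-0 = ∙-cancelˡ (φ (λ _ → 0)) _ _
    (trans (sym (φ-+ (λ _ → 0) (λ _ → 0))) (sym (identityʳ _)))

  Bounded : (Atom → ℕ) → Set
  Bounded v = ∀ a → v a ≤ H * 2

  φ-close : ∀ {v w} → Bounded v → Bounded w → φ v ≈ φ w → Close v w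
  φ-close {v} {w} v≤ w≤ eq a va≡ = coefficients-differ I (v≤ ∘ to) (w≤ ∘ to) eq (from a)
    (≡.subst (λ b → v b ≡ suc (w b)) (≡.sym (strictlyInverseˡ a)) va≡)

  Σvec-bounded : ∀ {L} → length L ≤ H → Bounded (Σvec L)
  Σvec-bounded {L} |L|≤H a = ℕ.≤-trans (Σvec≤ L a) (ℕ.*-monoˡ-≤ 2 |L|≤H)

  Image : Pred Point 0ℓ → Pred Carrier (c ⊔ ℓ)
  Image Q g = Lift c (∃[ s ] Q s × φ (vec s) ≈ g)

  sumset⁺ : ∀ {Q L} → All Q L → (length L · Image Q) (φ (Σvec L))
  sumset⁺ [] = (λ ()) , (λ ()) , sym φ-0
  sumset⁺ {Q} {s ∷ L} (Qs ∷ QL) with sumset⁺ QL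
  ... | a , Qa , eq = (λ { zero → φ (vec s) ; (suc i) → a i }) ,
    (λ { zero → lift (s , Qs , refl) ; (suc i) → Qa i }) ,
    trans (∙-congˡ eq) (sym (φ-+ (vec s) (Σvec L)))

  sumset⁻ : ∀ {Q} h {g} → (h · Image Q) g → ∃[ L ] All Q L × length L ≡ h × φ (Σvec L) ≈ g
  sumset⁻ zero (a , Qa , eq) = [] , [] , ≡.refl , trans φ-0 eq
  sumset⁻ {Q} (suc h) (a , Qa , eq) with Qa zero | sumset⁻ h (a ∘ suc , Qa ∘ suc , refl)
  ... | lift (s , Qs , s≈) | L , QL , |L| , L≈ =
    s ∷ L , Qs ∷ QL , cong suc |L| , trans (φ-+ (vec s) (Σvec L)) (trans (∙-cong s≈ L≈) eq)

  sumset-respects : ∀ h Q → (h · Image Q) Respects _≈_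
  sumset-respects h Q g≈g′ (a , Pa , eq) = a , Pa , trans eq g≈g′

  Image-finite : 0 < H → ∀ Q → IsFinite (Image Q)
  Image-finite 0<H Q = covered⇒finite (λ _ → em)
    (λ g≈g′ (lift (s , Qs , eq)) → lift (s , Qs , trans eq g≈g′))
    (span , λ (lift (s , _ , eq)) → Memₚ.∈-resp-≈ setoid eq
      (span-cover (vec s ∘ to) (λ i → ℕ.≤-trans (vec≤2 s (to i)) (ℕ.*-monoˡ-≤ 2 0<H))))

  sumset-finite : ∀ {h} → h ≤ H → ∀ Q → IsFinite (h · Image Q)
  sumset-finite {h} h≤H Q = covered⇒finite (λ _ → em) (sumset-respects h Q)
    (span , λ g∈ → let L , _ , |L| , eq = sumset⁻ h g∈ in
      Memₚ.∈-resp-≈ setoid eq (span-cover (Σvec L ∘ to)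
        (Σvec-bounded {L} (ℕ.≤-trans (ℕ.≤-reflexive |L|) h≤H) ∘ to)))

  private
    map-unique : ∀ {a} {X : Set a} (f : X → Carrier) {xs} →
      (∀ {u v} → u ∈ xs → v ∈ xs → f u ≈ f v → u ≡ v) →
      Unique xs → Uniqueᴳ (map f xs)
    map-unique f inj [] = []
    map-unique f {u ∷ xs} inj (u∉ ∷ xs!) =
      Allₚ.map⁺ (All.tabulate λ v∈ eq → All.lookup u∉ v∈ (inj (here ≡.refl) (there v∈) eq)) ∷
      map-unique f (λ u∈ v∈ → inj (there u∈) (there v∈)) xs!

  tip : Fin n × List (Fin H) → Carrier
  tip (i , p) = φ (Σvec (spike i p))

  A : List (Fin n) → Pred Carrier (c ⊔ ℓ)
  A = Image ∘ InA

  S : Pred Carrier (c ⊔ ℓ)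
  S = Image InS

  module _ {k : ℕ} (k<H : k < H) {cs : List (Fin n)} (cs! : Unique cs) where

    private
      spike-bounded : ∀ {i p} → length p ≡ k → Bounded (Σvec (spike i p))
      spike-bounded {i} {p} |p| = Σvec-bounded {spike i p}
        (ℕ.≤-trans (ℕ.≤-reflexive (cong suc (≡.trans (length-map _ p) |p|))) k<H)

      tip-injective : ∀ {u v} → u ∈ spikes k cs → v ∈ spikes k cs →
                      tip u ≈ tip v → u ≡ v
      tip-injective {i , p} {j , q} u∈ v∈ eq
        with i∈ , p∈ ← ∈-spikes⁻ {k} cs u∈ | j∈ , q∈ ← ∈-spikes⁻ {k} cs v∈
        with p! , p⊆ , |p| ← choose⁻ k (T! i) p∈ | q! , q⊆ , |q| ← choose⁻ k (T! j) q∈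
        with bp ← spike-bounded {i} {p} |p| | bq ← spike-bounded {j} {q} |q|
        with ≡.refl , p⊆q ← spike-injective {i} {p} {j} {q} p! (φ-close bp bq eq)
           | _ , q⊆p ← spike-injective {j} {q} {i} {p} q! (φ-close bq bp (sym eq)) =
        cong (i ,_) (choose-injective k (T! i) p∈ q∈ p⊆q q⊆p)

    -- `expand` shows that hS and the spikes exhaust the sumset, `avoid` that they are disjoint, and
    -- `spike-injective` that distinct spikes give distinct elements.
    sumset-cardinality : ∀ {N} → HasCardinality (suc k · S) N →
      HasCardinality (suc k · A cs) (N + binomials (map (length ∘ T) cs) k)
    sumset-cardinality (ys , ys! , |ys| , ys⇔) =
      ys ++ tips ,
      UniqueSetoidₚ.++⁺ setoid ys! (map-unique tip tip-injective (spikes-unique k cs!)) disjoint ,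
      ≡.trans (length-++ ys) (cong₂ _+_ |ys| (≡.trans (length-map tip (spikes k cs)) (length-spikes k cs))) ,
      λ g → mk⇔ forth back
      where
      tips : List Carrier
      tips = map tip (spikes k cs)

      tip⁻ : ∀ {g} → g ∈ᴳ tips → ∃[ i ] ∃[ p ] i ∈ cs × p ∈ choose k (T i) × g ≈ tip (i , p)
      tip⁻ g∈ with (i , p) , ip∈ , g≈ ← Memₚ.∈-map⁻ (≡.setoid _) setoid {f = tip} g∈ =
        i , p , proj₁ (∈-spikes⁻ cs ip∈) , proj₂ (∈-spikes⁻ cs ip∈) , g≈

      disjoint : ∀ {g} → ¬ (g ∈ᴳ ys × g ∈ᴳ tips)
      disjoint {g} (g∈ys , g∈tips)
        with i , p , i∈ , p∈ , g≈ ← tip⁻ g∈tips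
        with L , L⊆S , |L| , L≈ ← sumset⁻ (suc k) (Equivalence.from (ys⇔ g) g∈ys)
        with p! , p⊆ , |p| ← choose⁻ k (T! i) p∈ =
        avoid {i} {p} (p! , p⊆) L⊆S (≡.trans |L| (cong suc (≡.sym |p|)))
          (φ-close bL bp (trans L≈ g≈)) (φ-close bp bL (sym (trans L≈ g≈)))
        where
        bp = spike-bounded {i} {p} |p|
        bL = Σvec-bounded {L} (ℕ.≤-trans (ℕ.≤-reflexive |L|) k<H)

      forth : ∀ {g} → (suc k · A cs) g → g ∈ᴳ ys ++ tips
      forth {g} g∈ with L , L⊆A , |L| , L≈ ← sumset⁻ (suc k) g∈ with expand L⊆A
      ... | inj₁ (L′ , L′⊆S , |L′| , L′≗L) = Memₚ.∈-++⁺ˡ setoid (Equivalence.to (ys⇔ g)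
        (sumset-respects (suc k) InS (trans (φ-cong L′≗L) L≈)
          (≡.subst (λ h → (h · S) (φ (Σvec L′))) (≡.trans |L′| |L|) (sumset⁺ L′⊆S))))
      -- The leaves come in arbitrary order and are sorted into the representative listed by
      -- `choose`.
      ... | inj₂ (i , p , i∈ , (p! , p⊆) , |L|≡ , L≗)
        with q , q∈ , p↭q ← choose⁺ Fin._≟_ p! p⊆ =
        Memₚ.∈-++⁺ʳ setoid ys (Memₚ.∈-resp-≈ setoid tip≈g
          (Memₚ.∈-map⁺ (≡.setoid _) setoid {f = tip} (reflexive ∘ cong tip)
            (∈-spikes⁺ i∈ (≡.subst (λ l → q ∈ choose l (T i)) |p| q∈))))
        where
        |p| : length p ≡ k
        |p| = ℕ.suc-injective (≡.trans (≡.sym |L|≡) |L|)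
        tip≈g : tip (i , q) ≈ g
        tip≈g = trans (φ-cong (λ a → ≡.trans (≡.sym (Σvec-↭ (prep (centre i) (Permₚ.map⁺ _ p↭q)) a))
                                             (≡.sym (L≗ a)))) L≈

      back : ∀ {g} → g ∈ᴳ ys ++ tips → (suc k · A cs) g
      back {g} g∈ with Memₚ.∈-++⁻ setoid ys g∈
      ... | inj₁ g∈ys with a , Sa , eq ← Equivalence.from (ys⇔ g) g∈ys =
        a , (λ i → let lift (s , s∈S , s≈) = Sa i in lift (s , base s∈S , s≈)) , eq
      ... | inj₂ g∈tips
        with i , p , i∈ , p∈ , g≈ ← tip⁻ g∈tips
        with p! , p⊆ , |p| ← choose⁻ k (T! i) p∈ =
        sumset-respects (suc k) (InA cs) (sym g≈)
          (≡.subst (λ h → (h · A cs) (tip (i , p))) (cong suc (≡.trans (length-map _ p) |p|))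
            (sumset⁺ (spike⊆A p i∈)))

-- Assembling the two sets

extend : ∀ {H} → Vector ℤ H → ℕ → ℤ
extend {H} m k with k ℕ.<? H
... | yes k<H = m (fromℕ< k<H)
... | no _    = ℤ.0ℤ

extend-toℕ : ∀ {H} (m : Vector ℤ H) i → extend m (toℕ i) ≡ m i
extend-toℕ {H} m i with toℕ i ℕ.<? H
... | yes i<H = cong m (Fin.fromℕ<-toℕ i i<H)
... | no i≮H  = ⊥-elim (i≮H (Fin.toℕ<n i))

corollary1p4 :
    ∀ {c ℓ} → ExcludedMiddle (c ⊔ ℓ) →
    (G : AbelianGroup c ℓ) →
    let open AbelianGroup G using (Carrier)
        open Sumsets G in
    Infinite →
    (H : ℕ) .{{_ : NonZero H}} (m : Vector ℤ H) →
    Σ[ A ∈ Pred Carrier (c ⊔ ℓ) ] Σ[ B ∈ Pred Carrier (c ⊔ ℓ) ]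
      IsFinite A × IsFinite B ×
      (∀ (i : Fin H) → let h = suc (toℕ i) in
        ∃[ k ] ∃[ l ] HasCardinality (h · A) k × HasCardinality (h · B) l ×
          + k - + l ≡ m i)
corollary1p4 em G G-infinite H m
  with P , Q , P<H , Q<H , solves ← gap-surjective H (extend m) =
  A onA , A onB , Image-finite (>-nonZero⁻¹ H) _ , Image-finite (>-nonZero⁻¹ H) _ , λ i →
    -- Both sets extend the same S, so the common size `N` cancels in the difference.
    let N , N-card = sumset-finite (Fin.toℕ<n i) InS in
    _ , _ , sumset-cardinality (Fin.toℕ<n i) onA! N-card , sumset-cardinality (Fin.toℕ<n i) onB! N-card ,
    difference N i
  where
  p q : ℕ
  p = length P
  q = length Q

  -- There is one root for each entry of `P` and of `Q`; its `T` has as many leaves as that entry,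
  -- and since entries are below `H`, `H` leaves suffice.
  D : Fin (p + q) → ℕ
  D i = [ lookup P , lookup Q ]′ (splitAt p i)

  D≤H : ∀ i → D i ≤ H
  D≤H i with splitAt p i
  ... | inj₁ j = ℕ.<⇒≤ (All.lookup P<H (∈-lookup j))
  ... | inj₂ j = ℕ.<⇒≤ (All.lookup Q<H (∈-lookup j))

  T : Fin (p + q) → List (Fin H)
  T i = take (D i) (allFin H)

  length-T : ∀ i → length (T i) ≡ D i
  length-T i = ≡.trans (length-take (D i) (allFin H))
    (≡.trans (cong (D i ⊓_) (length-tabulate {n = H} id)) (ℕ.m≤n⇒m⊓n≡m (D≤H i)))

  open Realisation em G G-infinite H (p + q) T (λ i → Uniqueₚ.take⁺ (D i) (Uniqueₚ.allFin⁺ H))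
  open Gadgets (p + q) H T using (InS)

  onA onB : List (Fin (p + q))
  onA = map (_↑ˡ q) (allFin p)
  onB = map (p ↑ʳ_) (allFin q)

  onA! : Unique onA
  onA! = Uniqueₚ.map⁺ (λ {i} {j} → Fin.↑ˡ-injective q i j) (Uniqueₚ.allFin⁺ p)

  onB! : Unique onB
  onB! = Uniqueₚ.map⁺ (λ {i} {j} → Fin.↑ʳ-injective p i j) (Uniqueₚ.allFin⁺ q)

  sizes : ∀ (R : List ℕ) (f : Fin (length R) → Fin (p + q)) → (∀ j → D (f j) ≡ lookup R j) →
          map (length ∘ T) (map f (allFin (length R))) ≡ R
  sizes R f D∘f = ≡.trans (≡.sym (map-∘ (allFin _))) (≡.trans (map-tabulate id (length ∘ T ∘ f))
    (≡.trans (tabulate-cong (λ j → ≡.trans (length-T (f j)) (D∘f j))) (tabulate-lookup R)))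

  sizesA : map (length ∘ T) onA ≡ P
  sizesA = sizes P (_↑ˡ q) (λ j → cong [ lookup P , lookup Q ]′ (Fin.splitAt-↑ˡ p j q))

  sizesB : map (length ∘ T) onB ≡ Q
  sizesB = sizes Q (p ↑ʳ_) (λ j → cong [ lookup P , lookup Q ]′ (Fin.splitAt-↑ʳ p q j))

  difference : ∀ N i → + (N + binomials (map (length ∘ T) onA) (toℕ i)) -
                       + (N + binomials (map (length ∘ T) onB) (toℕ i)) ≡ m i
  difference N i rewrite sizesA | sizesB
    | ℤ.pos-+ N (binomials P (toℕ i)) | ℤ.pos-+ N (binomials Q (toℕ i)) =
    ≡.trans (cancel (+ N) (+ binomials P (toℕ i)) (+ binomials Q (toℕ i)))
      (≡.trans (solves (toℕ i) (Fin.toℕ<n i)) (extend-toℕ m i))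
    where
    cancel : ∀ z a b → (z ℤ.+ a) - (z ℤ.+ b) ≡ a - b
    cancel = solve-∀
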